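{- Let $k,t$ be integers with $k\geq t\geq 1$. Then there exists a connected graph $G=G_{k,t}$ with $\Delta(G)=2t^2+1$ and $\operatorname{diam}(G)=2t^2+1+k$ such that $prc(G)\geq rc(G)+t$.
   Context: A path in an edge-coloured graph is a rainbow path if its edges receive pairwise distinct colours. The rainbow connection number $rc(G)$ of a connected graph $G$ is the minimum number of colours in an edge-colouring such that every two distinct vertices are joined by a rainbow path. The proper rainbow connection number $prc(G)$ is the minimum number of colours in a proper edge-colouring (adjacent edges get distinct colours) such that every two distinct vertices are joined by a rainbow path. $\Delta(G)$ is the maximum degree and $\operatorname{diam}(G)$ the diameter. -}

module Defs where

open import Data.Bool using (Bool; false; T)
open import Data.Fin using (Fin)
open import Data.List using (List; []; _∷_; length; map; allFin; filterᵇ)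
open import Data.List.Extrema.Nat using (max)
open import Data.List.Relation.Unary.Unique.Propositional using (Unique)
open import Data.Nat using (ℕ; zero; suc; _≤_)
open import Data.Product using (Σ-syntax; ∃-syntax; _×_)
open import Relation.Binary.PropositionalEquality using (_≡_; _≢_)

IsMinimum : (ℕ → Set) → ℕ → Set
IsMinimum P m = P m × (∀ n → P n → m ≤ n)

IsMaximum : (ℕ → Set) → ℕ → Set
IsMaximum P m = P m × (∀ n → P n → n ≤ m)

-- Finite simple graphs on the vertex set Fin n.
record Graph (n : ℕ) : Set where
  field
    adj        : Fin n → Fin n → Bool
    adj-sym    : ∀ u v → adj u v ≡ adj v u
    adj-irrefl : ∀ v → adj v v ≡ false

module _ {n : ℕ} (G : Graph n) where
  open Graph G

  Adj : Fin n → Fin n → Set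
  Adj u v = T (adj u v)

  degree : Fin n → ℕ
  degree v = length (filterᵇ (adj v) (allFin n))

  Δ : ℕ
  Δ = max 0 (map degree (allFin n))

  data Walk : Fin n → Fin n → Set where
    []  : ∀ {v} → Walk v v
    _∷_ : ∀ {u v w} → Adj u v → Walk v w → Walk u w

  infixr 5 _∷_

module _ {n : ℕ} {G : Graph n} where

  walkLength : ∀ {u v} → Walk G u v → ℕ
  walkLength []      = zero
  walkLength (_ ∷ p) = suc (walkLength p)

  vertices : ∀ {u v} → Walk G u v → List (Fin n)
  vertices {u} []      = u ∷ []
  vertices {u} (_ ∷ p) = u ∷ vertices p

  IsPath : ∀ {u v} → Walk G u v → Set
  IsPath p = Unique (vertices p)

module _ {n : ℕ} (G : Graph n) where

  Connected : Set
  Connected = ∀ u v → Σ[ p ∈ Walk G u v ] IsPath p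

  IsDistance : Fin n → Fin n → ℕ → Set
  IsDistance u v =
    IsMinimum (λ d → Σ[ p ∈ Walk G u v ] IsPath p × walkLength p ≡ d)

  -- Pairs in different components are ignored, so this is the diameter
  -- only when G is connected.
  IsDiameter : ℕ → Set
  IsDiameter = IsMaximum (λ d → ∃[ u ] ∃[ v ] IsDistance u v d)

  -- Only edges are coloured.  Using colour-sym twice shows that the colour
  -- does not depend on the proof of adjacency, so this is a colouring of
  -- unordered edges.
  record EdgeColouring (m : ℕ) : Set where
    field
      colour     : ∀ {u v} → Adj G u v → Fin m
      colour-sym : ∀ {u v} (e : Adj G u v) (e′ : Adj G v u) →
                   colour e ≡ colour e′

module _ {n : ℕ} {G : Graph n} {m : ℕ} (c : EdgeColouring G m) where
  open EdgeColouring c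

  colours : ∀ {u v} → Walk G u v → List (Fin m)
  colours []      = []
  colours (e ∷ p) = colour e ∷ colours p

  IsRainbowPath : ∀ {u v} → Walk G u v → Set
  IsRainbowPath p = IsPath p × Unique (colours p)

  RainbowConnecting : Set
  RainbowConnecting = ∀ u v → u ≢ v → Σ[ p ∈ Walk G u v ] IsRainbowPath p

  Proper : Set
  Proper = ∀ {u v w} (e : Adj G u v) (e′ : Adj G u w) →
           v ≢ w → colour e ≢ colour e′

module _ {n : ℕ} (G : Graph n) where

  -- IsRc G r says rc(G) = r, and IsPrc G p says prc(G) = p.  An
  -- EdgeColouring G m need not use all m colours; this does not affect
  -- the minimum.
  IsRc : ℕ → Set
  IsRc = IsMinimum (λ m → Σ[ c ∈ EdgeColouring G m ] RainbowConnecting c)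

  IsPrc : ℕ → Set
  IsPrc = IsMinimum (λ m → Σ[ c ∈ EdgeColouring G m ] Proper c × RainbowConnecting c)

{-# OPTIONS --safe #-}

-- Take a path 0, …, L with L = 2t² + k, a second path L + 1, …, L + m (the rim)
-- with m = 2t², and join the hub L to every rim vertex.  Giving every edge
-- the residue modulo L + 1 of its smaller end makes the colouring rainbow
-- connecting: all spokes share one colour and the rim reuses bridge colours.
-- A rainbow path has at most as many edges as there are colours, so this also
-- bounds the diameter by L + 1, which the distance from 0 to the rim attains.
--
-- In a proper rainbow colouring with at most L + t colours, a rainbow path
-- from 0 to a rim vertex w uses the L bridges, then a spoke hub–x of a
-- non-bridge colour, then the rim from x to w in at most t − 1 edges.  Spokes
-- have distinct colours, so w is determined by the colour of hub–x and one of
-- the 2t − 1 possible values of w − x.  There are at most t non-bridge colours,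
-- whence 2t² = m ≤ t(2t − 1), a contradiction.
--
-- The number prc itself exists because proper rainbow colourability is
-- decidable and holds when all edges get different colours.

module Submission where

open import Defs
open import Data.Nat using (ℕ; _+_; _*_; _^_; _≥_)
open import Data.Product using (Σ-syntax; ∃-syntax; _×_)
open import Relation.Binary.PropositionalEquality using (_≡_)
open import Data.Bool using (true; false; T)
open import Data.Bool.Properties using (T?; T-irrelevant)
open import Data.Fin using (Fin; zero; suc; combine; toℕ; fromℕ; fromℕ<; inject₁; _↑ˡ_; _↑ʳ_)
open import Data.Fin.Properties using
  ( any?; all?; ¬Fin0; combine-injective; injective⇒≤; toℕ-injective; toℕ<n; toℕ-fromℕ; toℕ-fromℕ<
  ; toℕ-inject₁; toℕ-↑ˡ; toℕ-↑ʳ; ↑ʳ-injective; fromℕ<-injective; +↔⊎; *↔× )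
  renaming (_≟_ to _≟ᶠ_; ≤-total to ≤ᶠ-total; ≤-antisym to ≤ᶠ-antisym)
open import Data.List using (List; []; _∷_; _++_; length; lookup; map; allFin; filterᵇ; upTo)
open import Data.List.Extrema.Nat using (max≤v⁺; v≤max⁺)
open import Data.List.Membership.Propositional using (_∈_; lose)
open import Data.List.Membership.Propositional.Properties using
  (∈-lookup; ∈-allFin; ∈-map⁺; ∈-map⁻; ∈-filter⁺; ∈-filter⁻; ∈-upTo⁺; ∈-upTo⁻)
open import Data.List.Properties using (length-map; length-tabulate; length-upTo)
open import Data.List.Relation.Binary.Permutation.Propositional
  using (_↭_; ↭-refl; ↭-reflexive; ↭-sym; ↭-trans; prep; ↭⇒↭ₛ)
open import Data.List.Relation.Binary.Permutation.Propositional.Properties using (∷↭∷ʳ)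
import Data.List.Relation.Binary.Permutation.Setoid.Properties as Permutationₛ
open import Data.List.Relation.Binary.Subset.Propositional using (_⊆_)
open import Data.List.Relation.Unary.All as All using (All; []; _∷_)
open import Data.List.Relation.Unary.AllPairs using ([]; _∷_)
open import Data.List.Relation.Unary.Any using (here; there)
open import Data.List.Relation.Unary.Any.Properties using (lookup-index)
open import Data.List.Relation.Unary.Unique.Propositional using (Unique)
import Data.List.Relation.Unary.Unique.Propositional.Properties as Unique
import Data.List.Relation.Unary.Unique.DecPropositional as UniqueDec
open import Data.Nat using
  (zero; suc; pred; _∸_; ∣_-_∣; _≤_; _<_; z≤n; s≤s; _≟_; _≤?_; _<?_; NonZero; >-nonZero)
open import Data.Nat.DivMod using (_%_; _/_; _mod_; m≡m%n+[m/n]*n; m%n<n)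
open import Data.Nat.Properties
open import Data.Product using (∃; _,_; proj₁; proj₂; uncurry)
open import Data.Sum using (_⊎_; inj₁; inj₂; swap)
open import Data.Sum.Function.Propositional using (_⊎-↔_)
open import Data.Unit using (tt)
open import Data.Vec as Vec using (Vec; []; _∷_; tabulate)
open import Data.Vec.Properties using (lookup∘tabulate)
open import Function using (_∘_; mk⇔; mk↣; Injection)
open import Function.Construct.Composition using (_↔-∘_)
open import Function.Construct.Identity using (↔-id)
open import Function.Properties.Injection using (↣-trans)
open import Function.Properties.Inverse using (↔⇒↣; ↔-sym)
open import Relation.Binary using (tri<; tri≈; tri>)
open import Relation.Binary.PropositionalEquality using
  (_≢_; refl; sym; trans; cong; cong₂; subst; setoid)
open import Relation.Nullary using
  (¬_; Dec; yes; no; contradiction; ¬?; _×-dec_; _⊎-dec_; _→-dec_)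
open import Relation.Nullary.Decidable using
  (map′; ⌊_⌋; toWitness; fromWitness; does-⇔; dec-false; isYes≗does)

-- Lists without repetition and the pigeonhole principle.

lookup-injective : ∀ {A : Set} {xs : List A} → Unique xs →
                   ∀ {i j} → lookup xs i ≡ lookup xs j → i ≡ j
lookup-injective (_ ∷ _)  {zero}  {zero}  _  = refl
lookup-injective (x∉ ∷ _) {zero}  {suc j} eq = contradiction eq (All.lookup x∉ (∈-lookup j))
lookup-injective (x∉ ∷ _) {suc i} {zero}  eq = contradiction (sym eq) (All.lookup x∉ (∈-lookup i))
lookup-injective (_ ∷ u)  {suc i} {suc j} eq = cong suc (lookup-injective u eq)

-- Sending a position in `xs` to the position in `ys` where its element is found is an injection
-- between finite index sets.
Unique-⊆⇒length-≤ : ∀ {A : Set} {xs ys : List A} → Unique xs → xs ⊆ ys → length xs ≤ length ys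
Unique-⊆⇒length-≤ {xs = xs} {ys} u xs⊆ys = injective⇒≤ λ {i} {j} eq → lookup-injective u
  (trans (lookup-index (xs⊆ys (∈-lookup i)))
         (trans (cong (lookup ys) eq) (sym (lookup-index (xs⊆ys (∈-lookup j))))))

Unique⇒length-≤ : ∀ {m} {xs : List (Fin m)} → Unique xs → length xs ≤ m
Unique⇒length-≤ u =
  ≤-trans (Unique-⊆⇒length-≤ u (λ {i} _ → ∈-allFin i)) (≤-reflexive (length-tabulate _))

Unique-resp-↭ : ∀ {A : Set} {xs ys : List A} → xs ↭ ys → Unique xs → Unique ys
Unique-resp-↭ {A} = Permutationₛ.Unique-resp-↭ (setoid A) ∘ ↭⇒↭ₛ

-- Least witnesses and exhaustive search.

leastWitness : ∀ {P : ℕ → Set} → (∀ m → Dec (P m)) → ∀ n → P n → ∃ (IsMinimum P)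
leastWitness P? zero    p = 0 , p , λ _ _ → z≤n
leastWitness P? (suc n) p with P? 0
... | yes p₀ = 0 , p₀ , λ _ _ → z≤n
... | no ¬p₀ =
  let m , q , minimal = leastWitness (P? ∘ suc) n p
  in suc m , q , λ { zero p₀ → contradiction p₀ ¬p₀ ; (suc k) r → s≤s (minimal k r) }

-- This property passes from `Fin m` to vectors, and hence to the square tables that encode
-- edge-colourings.
Searchable : Set → Set₁
Searchable A = ∀ {P : A → Set} → (∀ a → Dec (P a)) → Dec (∃ P)

Vec-searchable : ∀ {A} → Searchable A → ∀ n → Searchable (Vec A n)
Vec-searchable search zero    P? = map′ (λ p → [] , p) (λ { ([] , p) → p }) (P? [])
Vec-searchable search (suc n) P? =
  map′ (λ (a , as , p) → a ∷ as , p) (λ { (a ∷ as , p) → a , as , p })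
       (search λ a → Vec-searchable search n λ as → P? (a ∷ as))

Σ-T? : ∀ {b} {P : T b → Set} → (∀ e → Dec (P e)) → Dec (∃ P)
Σ-T? {true}  P? = map′ (λ p → tt , p) proj₂ (P? tt)
Σ-T? {false} P? = no λ ()

Π-T? : ∀ {b} {P : T b → Set} → (∀ e → Dec (P e)) → Dec (∀ e → P e)
Π-T? {true}  P? = map′ (λ p _ → p) (λ f → f tt) (P? tt)
Π-T? {false} P? = yes λ ()

-- Unordered pairs of vertices, represented by the sorted pair.

ends : ∀ {n} → Fin n → Fin n → Fin n × Fin n
ends u v with ≤ᶠ-total u v
... | inj₁ _ = u , v
... | inj₂ _ = v , u

ends-≤ : ∀ {n} {u v : Fin n} → toℕ u ≤ toℕ v → ends u v ≡ (u , v)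
ends-≤ {u = u} {v} u≤v with ≤ᶠ-total u v
... | inj₁ _   = refl
... | inj₂ v≤u = cong₂ _,_ (≤ᶠ-antisym v≤u u≤v) (≤ᶠ-antisym u≤v v≤u)

ends-≥ : ∀ {n} {u v : Fin n} → toℕ v ≤ toℕ u → ends u v ≡ (v , u)
ends-≥ {u = u} {v} v≤u with ≤ᶠ-total u v
... | inj₁ u≤v = cong₂ _,_ (≤ᶠ-antisym u≤v v≤u) (≤ᶠ-antisym v≤u u≤v)
... | inj₂ _   = refl

ends-comm : ∀ {n} (u v : Fin n) → ends u v ≡ ends v u
ends-comm u v with ≤ᶠ-total u v
... | inj₁ u≤v = sym (ends-≥ u≤v)
... | inj₂ v≤u = sym (ends-≤ v≤u)

ends-sel : ∀ {n} (u v : Fin n) → ends u v ≡ (u , v) ⊎ ends u v ≡ (v , u)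
ends-sel u v with ≤ᶠ-total u v
... | inj₁ _ = inj₁ refl
... | inj₂ _ = inj₂ refl

ends-injective : ∀ {n} {u v x y : Fin n} → ends u v ≡ ends x y →
                 (u ≡ x × v ≡ y) ⊎ (u ≡ y × v ≡ x)
ends-injective {u = u} {v} {x} {y} eq with ends-sel u v | ends-sel x y
... | inj₁ p | inj₁ q with refl ← trans (sym p) (trans eq q) = inj₁ (refl , refl)
... | inj₁ p | inj₂ q with refl ← trans (sym p) (trans eq q) = inj₂ (refl , refl)
... | inj₂ p | inj₁ q with refl ← trans (sym p) (trans eq q) = inj₂ (refl , refl)
... | inj₂ p | inj₂ q with refl ← trans (sym p) (trans eq q) = inj₁ (refl , refl)

-- Reversal, length and bounded search of walks.

module _ {n : ℕ} {G : Graph n} where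
  open Graph G

  Adj-sym : ∀ {u v} → Adj G u v → Adj G v u
  Adj-sym {u} {v} = subst T (adj-sym u v)

  snoc : ∀ {u v w} → Walk G u v → Adj G v w → Walk G u w
  snoc []      e = e ∷ []
  snoc (d ∷ p) e = d ∷ snoc p e

  reverse : ∀ {u v} → Walk G u v → Walk G v u
  reverse []      = []
  reverse (e ∷ p) = snoc (reverse p) (Adj-sym e)

  -- Lists up to permutation suffice: reversal only has to preserve uniqueness, which does not
  -- depend on the order.
  vertices-snoc : ∀ {u v w} (p : Walk G u v) (e : Adj G v w) →
                  vertices (snoc p e) ↭ w ∷ vertices p
  vertices-snoc {w = w} p e =
    ↭-trans (↭-reflexive (lemma p)) (↭-sym (∷↭∷ʳ w (vertices p)))
    where
    lemma : ∀ {u v} (p : Walk G u v) {e : Adj G v w} → vertices (snoc p e) ≡ vertices p ++ w ∷ []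
    lemma []      = refl
    lemma (d ∷ p) = cong (_ ∷_) (lemma p)

  vertices-reverse : ∀ {u v} (p : Walk G u v) → vertices (reverse p) ↭ vertices p
  vertices-reverse []      = ↭-refl
  vertices-reverse (e ∷ p) =
    ↭-trans (vertices-snoc (reverse p) (Adj-sym e)) (prep _ (vertices-reverse p))

  source∈vertices : ∀ {u v} (p : Walk G u v) → u ∈ vertices p
  source∈vertices []      = here refl
  source∈vertices (_ ∷ _) = here refl

  module _ {m : ℕ} (c : EdgeColouring G m) where
    open EdgeColouring c

    colours-snoc : ∀ {u v w} (p : Walk G u v) (e : Adj G v w) →
                   colours c (snoc p e) ↭ colour e ∷ colours c p
    colours-snoc p e = ↭-trans (↭-reflexive (lemma p)) (↭-sym (∷↭∷ʳ (colour e) (colours c p)))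
      where
      lemma : ∀ {u} (p : Walk G u _) → colours c (snoc p e) ≡ colours c p ++ colour e ∷ []
      lemma []      = refl
      lemma (d ∷ p) = cong (_ ∷_) (lemma p)

    colours-reverse : ∀ {u v} (p : Walk G u v) → colours c (reverse p) ↭ colours c p
    colours-reverse []      = ↭-refl
    colours-reverse (e ∷ p) = ↭-trans (colours-snoc (reverse p) (Adj-sym e))
      (subst (λ x → x ∷ colours c (reverse p) ↭ colour e ∷ colours c p) (colour-sym e (Adj-sym e))
             (prep _ (colours-reverse p)))

    reverse-rainbow : ∀ {u v} {p : Walk G u v} → IsRainbowPath c p → IsRainbowPath c (reverse p)
    reverse-rainbow {p = p} (path , rainbow) =
      Unique-resp-↭ (↭-sym (vertices-reverse p)) path ,
      Unique-resp-↭ (↭-sym (colours-reverse p)) rainbow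

    length-colours : ∀ {u v} (p : Walk G u v) → length (colours c p) ≡ walkLength p
    length-colours []      = refl
    length-colours (_ ∷ p) = cong suc (length-colours p)

    rainbow⇒length-≤ : ∀ {u v} {p : Walk G u v} → IsRainbowPath c p → walkLength p ≤ m
    rainbow⇒length-≤ {p = p} (_ , rainbow) =
      ≤-trans (≤-reflexive (sym (length-colours p))) (Unique⇒length-≤ rainbow)

  -- Induction on the length bound: try every first edge and search the remainder with that edge
  -- prepended, then try the empty walk.
  Walk-search : ∀ ℓ {u v} {P : Walk G u v → Set} → (∀ p → Dec (P p)) →
                Dec (∃[ p ] walkLength p ≤ ℓ × P p)
  Walk-search zero {u} {v} P? with u ≟ᶠ v
  ... | no u≢v   = no λ { ([] , _) → u≢v refl }
  ... | yes refl = map′ (λ p → [] , z≤n , p) (λ { ([] , _ , p) → p }) (P? [])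
  Walk-search (suc ℓ) {u} {v} P?
    with any? (λ w → Σ-T? {adj u w} λ e → Walk-search ℓ {w} {v} (P? ∘ (e ∷_)))
  ... | yes (_ , e , p , ≤ℓ , q) = yes (e ∷ p , s≤s ≤ℓ , q)
  ... | no ¬step with u ≟ᶠ v
  ...   | no u≢v   = no λ { ([] , _) → u≢v refl ; (e ∷ p , s≤s ≤ℓ , q) → ¬step (_ , e , p , ≤ℓ , q) }
  ...   | yes refl with P? []
  ...     | yes q = yes ([] , z≤n , q)
  ...     | no ¬q = no λ { ([] , _ , q) → ¬q q ; (e ∷ p , s≤s ≤ℓ , q) → ¬step (_ , e , p , ≤ℓ , q) }

-- Decidability of proper rainbow colourability and existence of `prc`.

module _ {n : ℕ} (G : Graph n) where
  open Graph G
  open EdgeColouring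

  ProperRainbow : ∀ {m} → EdgeColouring G m → Set
  ProperRainbow c = Proper c × RainbowConnecting c

  ProperRainbowColourable : ℕ → Set
  ProperRainbowColourable m = Σ[ c ∈ EdgeColouring G m ] ProperRainbow c

  rainbowPath? : ∀ {m} (c : EdgeColouring G m) {u v} (p : Walk G u v) → Dec (IsRainbowPath c p)
  rainbowPath? c p =
    UniqueDec.unique? _≟ᶠ_ (vertices p) ×-dec UniqueDec.unique? _≟ᶠ_ (colours c p)

  proper? : ∀ {m} (c : EdgeColouring G m) → Dec (Proper c)
  proper? c = map′ (λ f {u} {v} {w} → f u v w) (λ f u v w → f {u} {v} {w})
    (all? λ u → all? λ v → all? λ w → Π-T? {adj u v} λ e → Π-T? {adj u w} λ e′ →
      ¬? (v ≟ᶠ w) →-dec ¬? (colour c e ≟ᶠ colour c e′))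

  rainbowConnecting? : ∀ {m} (c : EdgeColouring G m) → Dec (RainbowConnecting c)
  rainbowConnecting? {m} c = all? λ u → all? λ v → ¬? (u ≟ᶠ v) →-dec
    -- Cutting the search off at length `m` loses no rainbow path, since `m` colours allow none that
    -- is longer.
    map′ (λ (p , _ , r) → p , r) (λ (p , r) → p , rainbow⇒length-≤ c r , r)
         (Walk-search m (rainbowPath? c))

  module _ {m} {c c′ : EdgeColouring G m}
           (agree : ∀ {u v} (e : Adj G u v) → colour c e ≡ colour c′ e) where

    colours-cong : ∀ {u v} (p : Walk G u v) → colours c p ≡ colours c′ p
    colours-cong []      = refl
    colours-cong (e ∷ p) = cong₂ _∷_ (agree e) (colours-cong p)

    -- Passing through a table yields a colouring that agrees edge by edge with the original; both
    -- properties depend on those colours alone.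
    ProperRainbow-cong : ProperRainbow c → ProperRainbow c′
    ProperRainbow-cong (proper , connecting) =
      (λ e e′ v≢w eq → proper e e′ v≢w (trans (agree e) (trans eq (sym (agree e′))))) ,
      λ u v u≢v → let p , path , rainbow = connecting u v u≢v
                  in p , path , subst Unique (colours-cong p) rainbow

  pairColouring : ∀ {m} → (Fin n × Fin n → Fin m) → EdgeColouring G m
  pairColouring f = record
    { colour     = λ {u} {v} _ → f (ends u v)
    ; colour-sym = λ {u} {v} _ _ → cong f (ends-comm u v)
    }

  fromTable : ∀ {m} → Vec (Vec (Fin m) n) n → EdgeColouring G m
  fromTable t = pairColouring λ (u , v) → Vec.lookup (Vec.lookup t u) v

  module _ {m} (c : EdgeColouring G (suc m)) where

    entry : Fin n → Fin n → Fin (suc m)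
    entry u v with T? (adj u v)
    ... | yes e = colour c e
    -- Default for non-edges, which exists because there is at least one colour.
    ... | no _  = zero

    entry-colour : ∀ {u v} (e : Adj G u v) → entry u v ≡ colour c e
    entry-colour {u} {v} e with T? (adj u v)
    ... | yes e′ = cong (λ d → colour c d) (T-irrelevant e′ e)
    ... | no ¬e  = contradiction e ¬e

    toTable : Vec (Vec (Fin (suc m)) n) n
    toTable = tabulate λ u → tabulate (entry u)

    lookup-toTable : ∀ u v → Vec.lookup (Vec.lookup toTable u) v ≡ entry u v
    lookup-toTable u v =
      trans (cong (λ row → Vec.lookup row v) (lookup∘tabulate (λ u → tabulate (entry u)) u))
            (lookup∘tabulate (entry u) v)

    fromTable-toTable : ∀ {u v} (e : Adj G u v) → colour c e ≡ colour (fromTable toTable) e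
    fromTable-toTable {u} {v} e with ends-sel u v
    ... | inj₁ eq rewrite eq = sym (trans (lookup-toTable u v) (entry-colour e))
    -- Here the table is read at the reversed pair, so the edge is turned round first.
    ... | inj₂ eq rewrite eq =
      trans (colour-sym c e (Adj-sym {G = G} e))
            (sym (trans (lookup-toTable v u) (entry-colour (Adj-sym {G = G} e))))

  colourable? : ∀ {u v} → Adj G u v → ∀ m → Dec (ProperRainbowColourable m)
  -- Without colours the given edge cannot be coloured. This case is separate because tables need a
  -- default colour.
  colourable? e zero    = no λ (c , _) → ¬Fin0 (colour c e)
  colourable? e (suc m) =
    map′ (λ (t , q) → fromTable t , q)
         (λ (c , q) → toTable c , ProperRainbow-cong {c = c} (fromTable-toTable c) q)
         (Vec-searchable (Vec-searchable any? n) n λ t →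
           proper? (fromTable t) ×-dec rainbowConnecting? (fromTable t))

  injectiveColouring : EdgeColouring G (n * n)
  injectiveColouring = pairColouring (uncurry combine)

  injectiveColouring-injective :
    ∀ {u v x y} {e : Adj G u v} {d : Adj G x y} →
    colour injectiveColouring e ≡ colour injectiveColouring d →
    (u ≡ x × v ≡ y) ⊎ (u ≡ y × v ≡ x)
  injectiveColouring-injective {u} {v} {x} {y} eq =
    let p , q = combine-injective (proj₁ (ends u v)) (proj₂ (ends u v))
                                  (proj₁ (ends x y)) (proj₂ (ends x y)) eq
    in ends-injective (cong₂ _,_ p q)

  injectiveColouring-proper : Proper injectiveColouring
  injectiveColouring-proper e e′ v≢w eq with injectiveColouring-injective {e = e} {d = e′} eq
  ... | inj₁ (_ , v≡w)    = v≢w v≡w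
  ... | inj₂ (u≡w , v≡u)  = v≢w (trans v≡u u≡w)

  -- If a later edge had the colour of the first, both would be the same edge, and the first vertex
  -- would recur on the rest of the path.
  path⇒injectiveColours : ∀ {u v} (p : Walk G u v) → IsPath p →
                          Unique (colours injectiveColouring p)
  path⇒injectiveColours []      _          = []
  path⇒injectiveColours (_∷_ {u} {v} e p) (u∉p ∷ path) = fresh p u∉p ∷ path⇒injectiveColours p path
    where
    fresh : ∀ {x y} (q : Walk G x y) → All (u ≢_) (vertices q) →
            All (colour injectiveColouring {u} {v} e ≢_) (colours injectiveColouring q)
    fresh []      _           = []
    fresh (d ∷ q) (u≢x ∷ u∉q) =
      (λ eq → lemma (injectiveColouring-injective {e = e} {d = d} eq)) ∷ fresh q u∉q
      where
      lemma : ¬ _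
      lemma (inj₁ (u≡x , _)) = u≢x u≡x
      lemma (inj₂ (u≡y , _)) = All.lookup u∉q (source∈vertices q) u≡y

  prc-exists : ∀ {u v} → Adj G u v → Connected G → ∃ (IsPrc G)
  prc-exists e connected = leastWitness (colourable? e) (n * n)
    ( injectiveColouring , injectiveColouring-proper
    , λ u v _ → let p , path = connected u v in p , path , path⇒injectiveColours p path )

-- With equal residues, `i < j` forces a larger quotient for `j`, so `j` would be at least `i + N`.
mod-distinct : ∀ {i j} N .{{_ : NonZero N}} → i < j → j < i + N → i mod N ≢ j mod N
mod-distinct {i} {j} N i<j j<i+N eq = <-irrefl refl (begin-strict
  j                          <⟨ j<i+N ⟩
  i + N                      ≡⟨ cong (_+ N) (m≡m%n+[m/n]*n i N) ⟩
  i % N + i / N * N + N      ≡⟨ +-assoc (i % N) (i / N * N) N ⟩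
  i % N + (i / N * N + N)    ≡⟨ cong (i % N +_) (+-comm (i / N * N) N) ⟩
  i % N + suc (i / N) * N    ≤⟨ +-monoʳ-≤ (i % N) (*-monoˡ-≤ N i/N<j/N) ⟩
  i % N + j / N * N          ≡⟨ cong (_+ j / N * N) i%N≡j%N ⟩
  j % N + j / N * N          ≡⟨ m≡m%n+[m/n]*n j N ⟨
  j                          ∎)
  where
  open ≤-Reasoning
  i%N≡j%N : i % N ≡ j % N
  i%N≡j%N = trans (sym (toℕ-fromℕ< (m%n<n i N))) (trans (cong toℕ eq) (toℕ-fromℕ< (m%n<n j N)))
  i/N<j/N : i / N < j / N
  i/N<j/N = *-cancelʳ-< N (i / N) (j / N) (+-cancelˡ-< (i % N) (i / N * N) (j / N * N) (begin-strict
    i % N + i / N * N  ≡⟨ m≡m%n+[m/n]*n i N ⟨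
    i                  <⟨ i<j ⟩
    j                  ≡⟨ m≡m%n+[m/n]*n j N ⟩
    j % N + j / N * N  ≡⟨ cong (_+ j / N * N) i%N≡j%N ⟨
    i % N + j / N * N  ∎))

-- Degrees by comparison with explicit lists of vertex numbers.

module _ {n : ℕ} (G : Graph n) where
  open Graph G

  neighbours : Fin n → List ℕ
  neighbours v = map toℕ (filterᵇ (adj v) (allFin n))

  length-neighbours : ∀ v → length (neighbours v) ≡ degree G v
  length-neighbours v = length-map toℕ (filterᵇ (adj v) (allFin n))

  degree-≤ : ∀ {v} ys → (∀ {u} → Adj G v u → toℕ u ∈ ys) → degree G v ≤ length ys
  degree-≤ {v} ys covers = subst (_≤ length ys) (length-neighbours v)
    (Unique-⊆⇒length-≤ (Unique.map⁺ toℕ-injective (Unique.filter⁺ (T? ∘ adj v) (Unique.allFin⁺ n)))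
      λ i∈ → let u , u∈ , i≡u = ∈-map⁻ toℕ i∈
             in subst (_∈ ys) (sym i≡u) (covers (proj₂ (∈-filter⁻ (T? ∘ adj v) {xs = allFin n} u∈))))

  degree-≥ : ∀ {v ys} → Unique ys → (∀ {i} → i ∈ ys → ∃[ u ] Adj G v u × toℕ u ≡ i) →
             length ys ≤ degree G v
  degree-≥ {v} {ys} unique joined = subst (length ys ≤_) (length-neighbours v)
    (Unique-⊆⇒length-≤ unique λ i∈ → let u , e , u≡i = joined i∈
      in subst (_∈ neighbours v) u≡i (∈-map⁺ toℕ (∈-filter⁺ (T? ∘ adj v) (∈-allFin u) e)))

  Δ-≡ : ∀ {d v} → (∀ u → degree G u ≤ d) → d ≤ degree G v → Δ G ≡ d
  Δ-≡ {d} {v} bounded attained = ≤-antisym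
    (max≤v⁺ {xs = map (degree G) (allFin n)} z≤n (All.tabulate λ δ∈ →
      let u , _ , δ≡ = ∈-map⁻ (degree G) δ∈ in subst (_≤ d) (sym δ≡) (bounded u)))
    (v≤max⁺ 0 (map (degree G) (allFin n)) (inj₂ (lose (∈-map⁺ (degree G) (∈-allFin v)) attained)))

-- The graph: a path whose last vertex is the hub of a fan.

module Fan (L m : ℕ) where

  -- A step goes from the smaller to the larger end. The first clause gives both paths and also the
  -- spoke from `L` to `suc L`; the second gives all spokes.
  Step Link : ℕ → ℕ → Set
  Step i j = j ≡ suc i ⊎ (i ≡ L × L < j)
  Link i j = Step i j ⊎ Step j i

  step? : ∀ i j → Dec (Step i j)
  step? i j = j ≟ suc i ⊎-dec (i ≟ L ×-dec L <? j)

  -- Abstract so that splitting on toℕ u ≟ L does not reach inside the adjacency test.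
  abstract
    link? : ∀ i j → Dec (Link i j)
    link? i j = step? i j ⊎-dec step? j i

  step⇒< : ∀ {i j} → Step i j → i < j
  step⇒< (inj₁ refl)         = ≤-refl
  step⇒< (inj₂ (refl , L<j)) = L<j

  link-irrefl : ∀ i → ¬ Link i i
  link-irrefl i (inj₁ s) = <-irrefl refl (step⇒< s)
  link-irrefl i (inj₂ s) = <-irrefl refl (step⇒< s)

  order : ℕ
  order = suc L + m

  fan : Graph order
  fan = record
    { adj        = λ u v → ⌊ link? (toℕ u) (toℕ v) ⌋
    ; adj-sym    = λ u v → trans (isYes≗does (link? (toℕ u) (toℕ v)))
                     (trans (does-⇔ (mk⇔ swap swap) (link? (toℕ u) (toℕ v)) (link? (toℕ v) (toℕ u)))
                            (sym (isYes≗does (link? (toℕ v) (toℕ u)))))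
    ; adj-irrefl = λ v → trans (isYes≗does (link? (toℕ v) (toℕ v)))
                     (dec-false (link? (toℕ v) (toℕ v)) (link-irrefl (toℕ v)))
    }

  link : ∀ {u v} → Adj fan u v → Link (toℕ u) (toℕ v)
  link {u} {v} = toWitness {a? = link? (toℕ u) (toℕ v)}

  edge : ∀ {u v} → Link (toℕ u) (toℕ v) → Adj fan u v
  edge = fromWitness

  hub : Fin order
  hub = fromℕ L ↑ˡ m

  rim : Fin m → Fin order
  rim i = suc L ↑ʳ i

  toℕ-hub : toℕ hub ≡ L
  toℕ-hub = trans (toℕ-↑ˡ (fromℕ L) m) (toℕ-fromℕ L)

  toℕ-rim : ∀ i → toℕ (rim i) ≡ suc L + toℕ i
  toℕ-rim = toℕ-↑ʳ (suc L)

  L<rim : ∀ i → L < toℕ (rim i)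
  L<rim i = subst (L <_) (sym (toℕ-rim i)) (m≤m+n (suc L) (toℕ i))

  bridge : (i : Fin L) → Adj fan (inject₁ i ↑ˡ m) (suc i ↑ˡ m)
  bridge i = edge (inj₁ (inj₁ (trans (toℕ-↑ˡ (suc i) m)
    (cong suc (sym (trans (toℕ-↑ˡ (inject₁ i) m) (toℕ-inject₁ i)))))))

  -- Ascending walks and the residue colouring.

  data Ascending (B : ℕ) : ∀ {u v} → Walk fan u v → Set where
    []  : ∀ {v} → Ascending B ([] {v = v})
    _∷_ : ∀ {u v w} {e : Adj fan u v} {p : Walk fan v w} →
          (toℕ u < toℕ v × toℕ u < B) → Ascending B p → Ascending B (e ∷ p)

  -- Move to the next number, except that the hub jumps straight to the target. From `u` at most `L`
  -- every edge then starts at or before the hub, hence below `B`; in the other case the bound on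
  -- `v` ensures this.
  ascend : ∀ d {u v} B → toℕ v ≡ suc d + toℕ u → L < B → toℕ u ≤ L ⊎ toℕ v ≤ B →
           Σ[ p ∈ Walk fan u v ] Ascending B p
  ascend d {u} {v} B v≡ L<B bounded = go d v≡
    where
    u<v : toℕ u < toℕ v
    u<v = subst (toℕ u <_) (sym v≡) (s≤s (m≤n+m (toℕ u) d))
    u<B : toℕ u < B
    u<B = bound bounded
      where
      bound : toℕ u ≤ L ⊎ toℕ v ≤ B → toℕ u < B
      bound (inj₁ u≤L) = ≤-<-trans u≤L L<B
      bound (inj₂ v≤B) = <-≤-trans u<v v≤B
    direct : Step (toℕ u) (toℕ v) → Σ[ p ∈ Walk fan u v ] Ascending B p
    direct s = edge (inj₁ s) ∷ [] , (u<v , u<B) ∷ []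
    go : ∀ d → toℕ v ≡ suc d + toℕ u → Σ[ p ∈ Walk fan u v ] Ascending B p
    go zero    v≡ = direct (inj₁ v≡)
    go (suc d) v≡ with toℕ u ≟ L
    ... | yes u≡L = direct (inj₂ (u≡L , subst (_< toℕ v) u≡L u<v))
    ... | no  u≢L =
      let p , asc = ascend d {x} {v} B
                      (trans v≡ (trans (cong suc (sym (+-suc d (toℕ u)))) (cong (suc d +_) (sym x≡))))
                      L<B (next bounded)
      in edge (inj₁ (inj₁ x≡)) ∷ p , (≤-reflexive (sym x≡) , u<B) ∷ asc
      where
      x<n : suc (toℕ u) < order
      x<n = ≤-<-trans u<v (toℕ<n v)
      x : Fin order
      x = fromℕ< x<n
      x≡ : toℕ x ≡ suc (toℕ u)
      x≡ = toℕ-fromℕ< x<n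
      next : toℕ u ≤ L ⊎ toℕ v ≤ B → toℕ x ≤ L ⊎ toℕ v ≤ B
      next (inj₁ u≤L) = inj₁ (subst (_≤ L) (sym x≡) (≤∧≢⇒< u≤L u≢L))
      next (inj₂ v≤B) = inj₂ v≤B

  cyclic : EdgeColouring fan (suc L)
  cyclic = pairColouring fan λ (u , _) → toℕ u mod suc L

  open EdgeColouring cyclic using () renaming (colour to cyclicColour)

  cyclicColour-< : ∀ {u v} (e : Adj fan u v) → toℕ u < toℕ v → cyclicColour {u} {v} e ≡ toℕ u mod suc L
  cyclicColour-< _ u<v = cong (λ (u , _) → toℕ u mod suc L) (ends-≤ (<⇒≤ u<v))

  ascending-vertices : ∀ {B i u v} {p : Walk fan u v} → Ascending B p → i < toℕ u →
                       All (λ x → i < toℕ x) (vertices p)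
  ascending-vertices []                i<u = i<u ∷ []
  ascending-vertices ((u<v , _) ∷ asc) i<u = i<u ∷ ascending-vertices asc (<-trans i<u u<v)

  ascending-path : ∀ {B u v} {p : Walk fan u v} → Ascending B p → IsPath p
  ascending-path []                = [] ∷ []
  ascending-path ((u<v , _) ∷ asc) =
    All.map (λ i<x u≡x → <⇒≢ i<x (cong toℕ u≡x)) (ascending-vertices asc u<v) ∷ ascending-path asc

  -- Here `i` is the smaller end of an earlier edge; all later smaller ends lie strictly between `i`
  -- and `i + suc L`.
  ascending-fresh : ∀ {B i u v} {p : Walk fan u v} → Ascending B p → i < toℕ u → B ≤ i + suc L →
                    All (i mod suc L ≢_) (colours cyclic p)
  ascending-fresh [] _ _ = []
  ascending-fresh (_∷_ {e = e} (u<v , u<B) asc) i<u B≤ =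
    subst (_ ≢_) (sym (cyclicColour-< e u<v)) (mod-distinct (suc L) i<u (<-≤-trans u<B B≤))
    ∷ ascending-fresh asc (<-trans i<u u<v) B≤

  -- The smaller ends of the edges lie in a window of `suc L` consecutive numbers, where residues
  -- are distinct.
  ascending-rainbow : ∀ {B u v} {p : Walk fan u v} → Ascending B p → B ≤ toℕ u + suc L →
                      Unique (colours cyclic p)
  ascending-rainbow [] _ = []
  ascending-rainbow (_∷_ {e = e} (u<v , _) asc) B≤ =
    subst (λ x → All (x ≢_) _) (sym (cyclicColour-< e u<v)) (ascending-fresh asc u<v B≤)
    ∷ ascending-rainbow asc (≤-trans B≤ (+-monoˡ-≤ (suc L) (<⇒≤ u<v)))

  -- Rainbow connection, diameter and `rc`.

  module _ (m≤1+L : m ≤ suc L) where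

    cyclic-ascends : ∀ {u v} → toℕ u < toℕ v → Σ[ p ∈ Walk fan u v ] IsRainbowPath cyclic p
    cyclic-ascends {u} {v} u<v =
      let d , u+d≡v = m≤n⇒∃[o]m+o≡n u<v
          -- The largest bound for which residues of the smaller ends stay distinct.
          p , asc = ascend d (toℕ u + suc L)
                      (trans (sym u+d≡v) (cong suc (+-comm (toℕ u) d))) (m≤n+m (suc L) (toℕ u)) bounded
      in p , ascending-path asc , ascending-rainbow asc ≤-refl
      where
      bounded : toℕ u ≤ L ⊎ toℕ v ≤ toℕ u + suc L
      bounded with toℕ u ≤? L
      ... | yes u≤L = inj₁ u≤L
      -- Past the hub, `v` is below `suc L + m`, which is at most `u + suc L` because the rim has at
      -- most `suc L` vertices.
      ... | no  u≰L = inj₂ (≤-trans (<⇒≤ (toℕ<n v)) (+-mono-≤ (≰⇒> u≰L) m≤1+L))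

    cyclic-connecting : RainbowConnecting cyclic
    cyclic-connecting u v u≢v with <-cmp (toℕ u) (toℕ v)
    ... | tri< u<v _ _ = cyclic-ascends u<v
    ... | tri≈ _ u≡v _ = contradiction (toℕ-injective u≡v) u≢v
    ... | tri> _ _ v<u = let p , r = cyclic-ascends v<u in reverse p , reverse-rainbow cyclic {p = p} r

    fan-connected : Connected fan
    fan-connected u v with toℕ u ≟ toℕ v
    ... | yes eq with refl ← toℕ-injective eq = [] , [] ∷ []
    ... | no u≢v = let p , path , _ = cyclic-connecting u v (u≢v ∘ cong toℕ) in p , path

  -- An edge raises the vertex number by at most one unless it leaves the hub, and at the hub a
  -- single edge already gives the bound.
  walk-to-rim : ∀ {u w} (p : Walk fan u w) → L < toℕ w → L < toℕ u + walkLength p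
  walk-to-rim []                  L<w = ≤-trans L<w (≤-reflexive (sym (+-identityʳ _)))
  walk-to-rim (_∷_ {u} {v} e p) L<w = subst (L <_) (sym (+-suc (toℕ u) (walkLength p))) (lemma (link e))
    where
    lemma : Link (toℕ u) (toℕ v) → L < suc (toℕ u + walkLength p)
    lemma (inj₁ (inj₁ v≡))       = subst (λ x → L < x + walkLength p) v≡ (walk-to-rim p L<w)
    lemma (inj₁ (inj₂ (u≡L , _))) =
      s≤s (subst (_≤ toℕ u + walkLength p) u≡L (m≤m+n (toℕ u) (walkLength p)))
    lemma (inj₂ s) =
      <-trans (walk-to-rim p L<w) (s≤s (+-monoˡ-≤ (walkLength p) (<⇒≤ (step⇒< s))))

  module _ (m≤1+L : m ≤ suc L) (r₀ : Fin m) where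

    0≢rim : zero ≢ rim r₀
    0≢rim ()

    fan-diameter : IsDiameter fan (suc L)
    fan-diameter = (zero , rim r₀ , attained , λ { _ (p , _ , refl) → walk-to-rim p (L<rim r₀) }) , upper
      where
      attained : Σ[ p ∈ Walk fan zero (rim r₀) ] IsPath p × walkLength p ≡ suc L
      -- The length of the rainbow path is squeezed between `walk-to-rim` and the number of colours.
      attained = let p , r = cyclic-connecting m≤1+L zero (rim r₀) 0≢rim
                 in p , proj₁ r , ≤-antisym (rainbow⇒length-≤ cyclic {p = p} r) (walk-to-rim p (L<rim r₀))
      upper : ∀ d → ∃[ u ] ∃[ v ] IsDistance fan u v d → d ≤ suc L
      upper d (u , v , _ , shortest) with toℕ u ≟ toℕ v
      ... | yes eq with refl ← toℕ-injective eq = ≤-trans (shortest 0 ([] , [] ∷ [] , refl)) z≤n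
      ... | no u≢v = let p , r = cyclic-connecting m≤1+L u v (u≢v ∘ cong toℕ)
                     in ≤-trans (shortest _ (p , proj₁ r , refl)) (rainbow⇒length-≤ cyclic {p = p} r)

    fan-rc : IsRc fan (suc L)
    fan-rc = (cyclic , cyclic-connecting m≤1+L) , λ M (c , connecting) →
      let p , r = connecting zero (rim r₀) 0≢rim
      in ≤-trans (walk-to-rim p (L<rim r₀)) (rainbow⇒length-≤ c {p = p} r)

  -- Maximum degree.

  module _ (0<L : 0 < L) (2≤m : 2 ≤ m) where

    hubNeighbours : List ℕ
    hubNeighbours = pred L ∷ map (suc L +_) (upTo m)

    length-hubNeighbours : length hubNeighbours ≡ suc m
    length-hubNeighbours = cong suc (trans (length-map (suc L +_) (upTo m)) (length-upTo m))

    1+pred[L] : suc (pred L) ≡ L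
    1+pred[L] = suc-pred L {{>-nonZero 0<L}}

    hubNeighbours-unique : Unique hubNeighbours
    hubNeighbours-unique =
      All.tabulate (λ {i} i∈ eq → let j , _ , i≡ = ∈-map⁻ (suc L +_) i∈ in
        <⇒≢ (s≤s (≤-trans (pred[n]≤n {L}) (m≤m+n L j))) (trans eq i≡))
      ∷ Unique.map⁺ (+-cancelˡ-≡ (suc L) _ _) (Unique.upTo⁺ m)

    rim∈hubNeighbours : ∀ {v : Fin order} → L < toℕ v → toℕ v ∈ hubNeighbours
    rim∈hubNeighbours {v} L<v =
      let d , L+d≡v = m≤n⇒∃[o]m+o≡n L<v
      in there (subst (_∈ map (suc L +_) (upTo m)) L+d≡v (∈-map⁺ (suc L +_)
           (∈-upTo⁺ (+-cancelˡ-< (suc L) d m (subst (_< order) (sym L+d≡v) (toℕ<n v))))))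

    hub-degree-≤ : ∀ {u} → toℕ u ≡ L → degree fan u ≤ suc m
    hub-degree-≤ {u} u≡L = subst (degree fan u ≤_) length-hubNeighbours
      (degree-≤ fan hubNeighbours (covers ∘ link))
      where
      covers : ∀ {v} → Link (toℕ u) (toℕ v) → toℕ v ∈ hubNeighbours
      covers (inj₁ s)                = rim∈hubNeighbours (subst (_< _) u≡L (step⇒< s))
      covers (inj₂ (inj₁ u≡))        = here (cong pred (trans (sym u≡) u≡L))
      covers (inj₂ (inj₂ (_ , L<u))) = contradiction (sym u≡L) (<⇒≢ L<u)

    hub-degree-≥ : suc m ≤ degree fan hub
    hub-degree-≥ = subst (_≤ degree fan hub) length-hubNeighbours
      (degree-≥ fan hubNeighbours-unique joined)
      where
      joined : ∀ {i} → i ∈ hubNeighbours → ∃[ u ] Adj fan hub u × toℕ u ≡ i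
      joined (here refl) =
        fromℕ< i<n
        , edge (inj₂ (inj₁ (trans toℕ-hub (sym (trans (cong suc (toℕ-fromℕ< i<n)) 1+pred[L])))))
        , toℕ-fromℕ< i<n
        where
        i<n : pred L < order
        i<n = s≤s (≤-trans (pred[n]≤n {L}) (m≤m+n L m))
      joined (there i∈) =
        let j , j∈ , i≡ = ∈-map⁻ (suc L +_) i∈
            j<m = ∈-upTo⁻ j∈
            k = fromℕ< j<m
        in rim k , edge (inj₁ (inj₂ (toℕ-hub , L<rim k)))
         , trans (toℕ-rim k) (trans (cong (suc L +_) (toℕ-fromℕ< j<m)) (sym i≡))

    -- Only the two adjacent numbers and the hub can be neighbours, and `2 ≤ m` makes three at most
    -- `suc m`. Repetitions in the list do no harm to an upper bound.
    other-degree-≤ : ∀ {u} → toℕ u ≢ L → degree fan u ≤ suc m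
    other-degree-≤ {u} u≢L =
      ≤-trans (degree-≤ fan (suc (toℕ u) ∷ pred (toℕ u) ∷ L ∷ []) (covers ∘ link)) (s≤s 2≤m)
      where
      covers : ∀ {v} → Link (toℕ u) (toℕ v) → toℕ v ∈ suc (toℕ u) ∷ pred (toℕ u) ∷ L ∷ []
      covers (inj₁ (inj₁ v≡))        = here v≡
      covers (inj₁ (inj₂ (u≡L , _))) = contradiction u≡L u≢L
      covers (inj₂ (inj₁ u≡))        = there (here (sym (cong pred u≡)))
      covers (inj₂ (inj₂ (v≡L , _))) = there (there (here v≡L))

    degree-≤-1+m : ∀ u → degree fan u ≤ suc m
    degree-≤-1+m u with toℕ u ≟ L
    ... | yes u≡L = hub-degree-≤ u≡L
    ... | no  u≢L = other-degree-≤ u≢L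

    fan-Δ : Δ fan ≡ suc m
    fan-Δ = Δ-≡ fan degree-≤-1+m hub-degree-≥

  -- Lower bound for `prc`: the shape of rainbow paths to the rim.

  rim-distance-≤ : ∀ {u v} (p : Walk fan u v) → All (λ x → L < toℕ x) (vertices p) →
            ∣ toℕ u - toℕ v ∣ ≤ walkLength p
  rim-distance-≤ {u} [] _ = ≤-reflexive (∣n-n∣≡0 (toℕ u))
  rim-distance-≤ {v = w} (_∷_ {u} {v} e p) (L<u ∷ L<p) =
    ≤-trans (∣-∣-triangle (toℕ u) (toℕ v) (toℕ w)) (+-mono-≤ (unit (link e)) (rim-distance-≤ p L<p))
    where
    ∣n-1+n∣≡1 : ∀ i → ∣ i - suc i ∣ ≡ 1
    ∣n-1+n∣≡1 i = trans (cong ∣ i -_∣ (+-comm 1 i)) (∣m-m+n∣≡n i 1)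
    -- On the rim only consecutive numbers are joined; the spoke cases fail since neither end is the
    -- hub.
    unit : Link (toℕ u) (toℕ v) → ∣ toℕ u - toℕ v ∣ ≤ 1
    unit (inj₁ (inj₁ v≡)) = ≤-reflexive (trans (cong ∣ toℕ u -_∣ v≡) (∣n-1+n∣≡1 (toℕ u)))
    unit (inj₁ (inj₂ (u≡L , _))) = contradiction (sym u≡L) (<⇒≢ L<u)
    unit (inj₂ (inj₁ u≡)) = ≤-reflexive (trans (∣-∣-comm (toℕ u) (toℕ v))
      (trans (cong ∣ toℕ v -_∣ u≡) (∣n-1+n∣≡1 (toℕ v))))
    unit (inj₂ (inj₂ (v≡L , _))) = contradiction (sym v≡L) (<⇒≢ (All.lookup L<p (source∈vertices p)))

  module _ {M : ℕ} (c : EdgeColouring fan M) where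
    open EdgeColouring c

    bridgeColour : Fin L → Fin M
    bridgeColour i = colour (bridge i)

    -- The data that the counting takes from a rainbow path. The restriction to bridges from `u`
    -- onwards permits induction along the path, and at vertex 0 it covers all bridges. The two
    -- membership fields show that the colour of an edge put in front is new.
    record Exit {u w} (p : Walk fan u w) : Set where
      field
        spoke            : Fin order
        hub-spoke        : Adj fan hub spoke
        far              : L + suc ∣ toℕ spoke - toℕ w ∣ ≤ toℕ u + walkLength p
        spokeColour∈     : colour hub-spoke ∈ colours c p
        bridgeColour∈    : ∀ i → toℕ u ≤ toℕ i → bridgeColour i ∈ colours c p
        bridges-distinct : ∀ {i j} → toℕ u ≤ toℕ i → toℕ u ≤ toℕ j →
                           bridgeColour i ≡ bridgeColour j → i ≡ j
        spoke-new        : ∀ i → toℕ u ≤ toℕ i → bridgeColour i ≢ colour hub-spoke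

    -- No vertex of the path is numbered below its start, and a path never returns to its start, so
    -- this persists for the remainder. Hence the path can only climb bridge by bridge to the hub,
    -- and after the hub it stays on the rim.
    exit : ∀ {u w} (p : Walk fan u w) → IsRainbowPath c p → toℕ u ≤ L → L < toℕ w →
           All (λ x → toℕ u ≤ toℕ x) (vertices p) → Exit p
    exit [] _ u≤L L<w _ = contradiction u≤L (<⇒≱ L<w)
    exit {w = w} (_∷_ {u} {x} e p) (u∉p ∷ path , e∉p ∷ rainbow) u≤L L<w (_ ∷ u≤p) with toℕ u ≟ L
    ... | yes u≡L with refl ← toℕ-injective {i = u} {hub} (trans u≡L (sym toℕ-hub)) = record
      { spoke            = x
      ; hub-spoke        = e
      ; far              = +-mono-≤ (≤-reflexive (sym u≡L)) (s≤s (rim-distance-≤ p L<p))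
      ; spokeColour∈     = here refl
      ; bridgeColour∈    = λ i u≤i → contradiction u≤i (beyond i)
      ; bridges-distinct = λ {i} u≤i → contradiction u≤i (beyond i)
      ; spoke-new        = λ i u≤i → contradiction u≤i (beyond i)
      }
      where
      L<p : All (λ y → L < toℕ y) (vertices p)
      L<p = All.zipWith
        (λ {y} (u≤y , u≢y) → subst (_< toℕ y) u≡L (≤∧≢⇒< u≤y (u≢y ∘ toℕ-injective))) (u≤p , u∉p)
      beyond : ∀ (i : Fin L) → ¬ toℕ u ≤ toℕ i
      beyond i = <⇒≱ (subst (toℕ i <_) (sym u≡L) (toℕ<n i))
    ... | no u≢L = record
      { spoke            = spoke
      ; hub-spoke        = hub-spoke
      ; far              = ≤-trans far (≤-reflexive
          (trans (cong (_+ walkLength p) x≡) (sym (+-suc (toℕ u) (walkLength p)))))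
      ; spokeColour∈     = there spokeColour∈
      ; bridgeColour∈    = λ i u≤i → ∈-case i (position i u≤i)
      ; bridges-distinct = λ {i} {j} u≤i u≤j → distinct-case (position i u≤i) (position j u≤j)
      ; spoke-new        = λ i u≤i → new-case (position i u≤i)
      }
      where
      u<L : toℕ u < L
      u<L = ≤∧≢⇒< u≤L u≢L
      u<p : All (λ y → toℕ u < toℕ y) (vertices p)
      u<p = All.zipWith (λ (u≤y , u≢y) → ≤∧≢⇒< u≤y (u≢y ∘ toℕ-injective)) (u≤p , u∉p)
      next : Link (toℕ u) (toℕ x) → toℕ x ≡ suc (toℕ u)
      next (inj₁ (inj₁ x≡))        = x≡
      next (inj₁ (inj₂ (u≡L , _))) = contradiction u≡L u≢L
      next (inj₂ s) = contradiction (step⇒< s) (<-asym (All.lookup u<p (source∈vertices p)))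
      x≡ : toℕ x ≡ suc (toℕ u)
      x≡ = next (link e)
      here-bridge : Fin L
      here-bridge = fromℕ< u<L
      position : ∀ i → toℕ u ≤ toℕ i → i ≡ here-bridge ⊎ toℕ x ≤ toℕ i
      position i u≤i with toℕ u ≟ toℕ i
      ... | yes u≡i = inj₁ (toℕ-injective (trans (sym u≡i) (sym (toℕ-fromℕ< u<L))))
      ... | no  u≢i = inj₂ (subst (_≤ toℕ i) (sym x≡) (≤∧≢⇒< u≤i u≢i))
      -- Both edges join the same vertices, and adjacency proofs are unique.
      colour-here : colour e ≡ bridgeColour here-bridge
      colour-here = coincide e (bridge here-bridge)
        (toℕ-injective (sym (trans (toℕ-↑ˡ _ m) (trans (toℕ-inject₁ here-bridge) (toℕ-fromℕ< u<L)))))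
        (toℕ-injective (sym (trans (toℕ-↑ˡ (suc here-bridge) m)
          (trans (cong suc (toℕ-fromℕ< u<L)) (sym x≡)))))
        where
        coincide : ∀ {u v u′ v′} (e : Adj fan u v) (e′ : Adj fan u′ v′) →
                   u ≡ u′ → v ≡ v′ → colour e ≡ colour e′
        coincide e e′ refl refl = cong colour (T-irrelevant e e′)
      open Exit (exit p (path , rainbow) (subst (_≤ L) (sym x≡) u<L) L<w
                  (All.map (λ u<y → subst (_≤ _) (sym x≡) u<y) u<p))
      fresh : ∀ {a} → a ∈ colours c p → bridgeColour here-bridge ≢ a
      fresh a∈ eq = All.lookup e∉p a∈ (trans colour-here eq)
      ∈-case : ∀ i → i ≡ here-bridge ⊎ toℕ x ≤ toℕ i → bridgeColour i ∈ colours c (e ∷ p)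
      ∈-case i (inj₁ refl) = here (sym colour-here)
      ∈-case i (inj₂ x≤i)  = there (bridgeColour∈ i x≤i)
      distinct-case : ∀ {i j} → i ≡ here-bridge ⊎ toℕ x ≤ toℕ i → j ≡ here-bridge ⊎ toℕ x ≤ toℕ j →
                      bridgeColour i ≡ bridgeColour j → i ≡ j
      distinct-case (inj₁ refl) (inj₁ refl) _  = refl
      distinct-case (inj₁ refl) (inj₂ x≤j)  eq = contradiction eq (fresh (bridgeColour∈ _ x≤j))
      distinct-case (inj₂ x≤i)  (inj₁ refl) eq = contradiction (sym eq) (fresh (bridgeColour∈ _ x≤i))
      distinct-case (inj₂ x≤i)  (inj₂ x≤j)  eq = bridges-distinct x≤i x≤j eq
      new-case : ∀ {i} → i ≡ here-bridge ⊎ toℕ x ≤ toℕ i → bridgeColour i ≢ colour hub-spoke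
      new-case (inj₁ refl) = fresh spokeColour∈
      new-case (inj₂ x≤i)  = spoke-new _ x≤i

    module _ (proper : Proper c) (connecting : RainbowConnecting c) where

      rimExit : ∀ i → Σ[ p ∈ Walk fan zero (rim i) ] IsRainbowPath c p × Exit p
      rimExit i = let p , r = connecting zero (rim i) (λ ())
                       in p , r , exit p r z≤n (L<rim i) (All.tabulate λ _ → z≤n)

      module At (i : Fin m) = Exit (proj₂ (proj₂ (rimExit i)))

      -- Counting rim vertices when there are at most `L + suc s` colours.

      module _ (s : ℕ) (M≤ : M ≤ L + suc s) (r₀ : Fin m) where

        -- The differences between a rim vertex and its spoke range over `-s, …, s`; shifted by `s`
        -- they become `0, …, s + s`.
        offsets : ℕ
        offsets = suc (s + s)

        -- Of at most `L + suc s` edges, `L` are spent on reaching the hub and one on the spoke.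
        spoke-near : ∀ i → ∣ toℕ (At.spoke i) - toℕ (rim i) ∣ ≤ s
        spoke-near i =
          let p , r , _ = rimExit i
          in ≤-pred (+-cancelˡ-≤ L _ _ (≤-trans (At.far i) (≤-trans (rainbow⇒length-≤ c {p = p} r) M≤)))

        spoke-≤ : ∀ i → toℕ (At.spoke i) ≤ toℕ (rim i) + s
        spoke-≤ i = ≤-trans (m≤n+∣m-n∣ (toℕ (At.spoke i)) (toℕ (rim i)))
          (+-monoʳ-≤ (toℕ (rim i)) (spoke-near i))

        spoke-≥ : ∀ i → toℕ (rim i) ≤ toℕ (At.spoke i) + s
        spoke-≥ i = ≤-trans (m≤n+∣n-m∣ (toℕ (rim i)) (toℕ (At.spoke i)))
          (+-monoʳ-≤ (toℕ (At.spoke i)) (spoke-near i))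

        offset-< : ∀ i → toℕ (rim i) + s ∸ toℕ (At.spoke i) < offsets
        offset-< i = s≤s (m≤n+o⇒m∸n≤o (toℕ (rim i) + s) (toℕ (At.spoke i))
          (≤-trans (+-monoˡ-≤ s (spoke-≥ i)) (≤-reflexive (+-assoc (toℕ (At.spoke i)) s s))))

        -- Including all pairs of a bridge and an offset lets one injection do the count: cancelling
        -- `L * offsets` leaves at most `suc s` colours for the rim vertices.
        code : (Fin L × Fin offsets) ⊎ Fin m → Fin M × Fin offsets
        code (inj₁ (i , o)) = bridgeColour i , o
        code (inj₂ i)       = colour (At.hub-spoke i) , fromℕ< (offset-< i)

        -- By `spoke-≤` the truncated subtraction is exact and can be cancelled.
        spoke-determines-rim : ∀ {i j} → At.spoke i ≡ At.spoke j →
          fromℕ< (offset-< i) ≡ fromℕ< (offset-< j) → i ≡ j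
        spoke-determines-rim {i} {j} spoke≡ offset≡ = ↑ʳ-injective (suc L) i j (toℕ-injective
          (+-cancelʳ-≡ s (toℕ (rim i)) (toℕ (rim j)) (∸-cancelʳ-≡ (spoke-≤ i)
            (subst (λ x → toℕ x ≤ toℕ (rim j) + s) (sym spoke≡) (spoke-≤ j))
            (trans (fromℕ<-injective _ _ (offset-< i) (offset-< j) offset≡)
                   (cong (λ x → toℕ (rim j) + s ∸ toℕ x) (sym spoke≡))))))

        code-injective : ∀ {x y} → code x ≡ code y → x ≡ y
        code-injective {inj₁ (i , o)} {inj₁ (j , o′)} eq =
          -- Every path from 0 to the rim crosses all bridges, so the one to `r₀` shows that their
          -- colours differ.
          cong₂ (λ i o → inj₁ (i , o)) (At.bridges-distinct r₀ z≤n z≤n (cong proj₁ eq)) (cong proj₂ eq)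
        code-injective {inj₁ (i , _)} {inj₂ j} eq = contradiction (cong proj₁ eq) (At.spoke-new j i z≤n)
        code-injective {inj₂ i} {inj₁ (j , _)} eq = contradiction (sym (cong proj₁ eq)) (At.spoke-new i j z≤n)
        code-injective {inj₂ i} {inj₂ j} eq with At.spoke i ≟ᶠ At.spoke j
        ... | yes spoke≡ = cong inj₂ (spoke-determines-rim spoke≡ (cong proj₂ eq))
        -- Properness at the hub: different spokes have different colours.
        ... | no  spoke≢ = contradiction (cong proj₁ eq) (proper (At.hub-spoke i) (At.hub-spoke j) spoke≢)

        code-count : L * offsets + m ≤ M * offsets
        code-count = injective⇒≤ (Injection.injective
          (↣-trans (↔⇒↣ ((*↔× ⊎-↔ ↔-id _) ↔-∘ +↔⊎)) (↣-trans (mk↣ code-injective) (↔⇒↣ (↔-sym *↔×)))))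

        rim-count : m ≤ suc s * offsets
        rim-count = +-cancelˡ-≤ (L * offsets) m (suc s * offsets) (≤-trans code-count
          (≤-trans (*-monoˡ-≤ offsets M≤) (≤-reflexive (*-distribʳ-+ offsets L (suc s)))))

  fan-prc-> : ∀ {M} s → IsPrc fan M → suc s * suc (s + s) < m → Fin m → L + suc s < M
  fan-prc-> s ((c , proper , connecting) , _) small r₀ =
    ≰⇒> λ M≤ → <⇒≱ small (rim-count c proper connecting s M≤ r₀)

-- Choice of the parameters.

theorem3p4 : ∀ (k t : ℕ) → k ≥ t → t ≥ 1 →
    Σ[ n ∈ ℕ ] Σ[ G ∈ Graph n ]
    (Connected G
    × Δ G ≡ 2 * t ^ 2 + 1
    × IsDiameter G (2 * t ^ 2 + 1 + k)
    × (∃[ r ] ∃[ p ] (IsRc G r × IsPrc G p × p ≥ r + t)))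
theorem3p4 k t@(suc s) _ _ =
  order , fan , connected
  , trans (fan-Δ (≤-trans (<⇒≤ 2≤m) m≤L) 2≤m) (+-comm 1 m)
  , subst (IsDiameter fan) (cong (_+ k) (+-comm 1 m)) (fan-diameter m≤1+L r₀)
  -- The strict bound `L + t < prc` is by definition `suc L + t ≤ prc`, the required gap above `rc`.
  , suc L , proj₁ prc , fan-rc m≤1+L r₀ , proj₂ prc , fan-prc-> s (proj₂ prc) small r₀
  where
  m L : ℕ
  -- The value of `L` below makes `suc L` the required diameter and keeps the rim within `suc L`
  -- vertices.
  m = 2 * t ^ 2
  L = m + k
  open Fan L m
  m≡t*[t+t] : m ≡ t * (t + t)
  m≡t*[t+t] = trans (*-comm 2 (t ^ 2))
    (trans (cong (_* 2) (cong (t *_) (*-identityʳ t)))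
      (trans (*-assoc t t 2) (cong (t *_) (trans (*-comm t 2) (cong (t +_) (+-identityʳ t))))))
  -- As `t` is `suc s`, the factor `suc (s + s)` is `2t - 1`, one less than the `t + t` in `m`.
  small : t * suc (s + s) < m
  small = subst (t * suc (s + s) <_) (sym m≡t*[t+t])
    (*-monoʳ-< t (s≤s (≤-reflexive (sym (+-suc s s)))))
  2≤m : 2 ≤ m
  2≤m = ≤-trans (s≤s (s≤s z≤n)) small
  m≤L : m ≤ L
  m≤L = m≤m+n m k
  m≤1+L : m ≤ suc L
  m≤1+L = m≤n⇒m≤1+n m≤L
  r₀ : Fin m
  r₀ = fromℕ< (<⇒≤ 2≤m)
  connected : Connected fan
  connected = fan-connected m≤1+L
  prc : ∃ (IsPrc fan)
  prc = prc-exists fan (edge {hub} {rim r₀} (inj₁ (inj₂ (toℕ-hub , L<rim r₀)))) connected
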